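{- For every $k\in\mathbb{N}$ there exist connected graphs $G$, $H$ and permutations $\pi:V_G\to V_G$, $\sigma:V_H\to V_H$ such that $\gamma_{wcon}(G)-\gamma_{wcon}(\pi G)\ge k$ and $\gamma_{wcon}(\sigma H)-2\gamma_{wcon}(H)\ge k$.
   Context: Graphs are finite, simple, undirected and nonempty. For a graph $G$ with vertex set $V_G$ and a permutation $\pi$ of $V_G$, let $G'$ be a vertex-disjoint copy of $G$, with $v'$ the copy of $v$. The prism graph $\pi G$ has vertex set $V_G\cup V_{G'}$ and edge set $E_G\cup E_{G'}\cup\{u\,\pi(u)':u\in V_G\}$. A set $A$ of vertices is dominating if every vertex of the graph is in $A$ or adjacent to a vertex of $A$. In a connected graph, $A$ is weakly convex if for every $u,v\in A$ it contains all vertices of at least one shortest $u$--$v$ path of the graph. $\gamma_{wcon}$ denotes the minimum cardinality of a weakly convex dominating set. -}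

module Defs where

open import Data.Fin.Base using (Fin; splitAt; _↑ˡ_)
open import Data.Fin.Permutation using (Permutation′; _⟨$⟩ʳ_)
open import Data.Fin.Properties using (_≟_)
open import Data.Fin.Subset using (Subset; _∈_; ∣_∣)
open import Data.List.Base using (List; []; _∷_)
open import Data.List.Relation.Unary.All using (All)
open import Data.List.Relation.Unary.Unique.Propositional using (Unique)
open import Data.Nat.Base using (ℕ; zero; suc; _+_; _≤_)
open import Data.Product.Base using (_×_; ∃-syntax; Σ-syntax)
open import Data.Sum.Base using (_⊎_; inj₁; inj₂)
open import Function.Base using (_on_)
open import Level using (0ℓ)
open import Relation.Binary.Construct.Closure.ReflexiveTransitive using (Star; ε; _◅_)
open import Relation.Binary.Core using (Rel)
open import Relation.Binary.Definitions using (Decidable; Irreflexive; Symmetric)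
open import Relation.Binary.PropositionalEquality.Core using (_≡_; refl)

record Graph : Set₁ where
  infix 4 _~_ _~?_
  field
    order    : ℕ
    nonempty : Fin order
    _~_      : Rel (Fin order) 0ℓ
    _~?_     : Decidable _~_
    ~-sym    : Symmetric _~_
    ~-irrefl : Irreflexive _≡_ _~_

  Vertex : Set
  Vertex = Fin order

  VertexSet : Set
  VertexSet = Subset order

  Walk : Rel Vertex 0ℓ
  Walk = Star _~_

  Connected : Set
  Connected = ∀ u v → Walk u v

  vertices : ∀ {u v} → Walk u v → List Vertex
  vertices {u} ε       = u ∷ []
  vertices {u} (_ ◅ w) = u ∷ vertices w

  len : ∀ {u v} → Walk u v → ℕ
  len ε       = zero
  len (_ ◅ w) = suc (len w)

  IsPath : ∀ {u v} → Walk u v → Set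
  IsPath w = Unique (vertices w)

  IsShortestPath : ∀ {u v} → Walk u v → Set
  IsShortestPath {u} {v} p =
    IsPath p × (∀ (q : Walk u v) → IsPath q → len p ≤ len q)

  Dominating : VertexSet → Set
  Dominating A = ∀ v → v ∈ A ⊎ (∃[ u ] u ∈ A × v ~ u)

  WeaklyConvex : VertexSet → Set
  WeaklyConvex A = ∀ u v → u ∈ A → v ∈ A →
    Σ[ p ∈ Walk u v ] IsShortestPath p × All (_∈ A) (vertices p)

  WeaklyConvexDominating : VertexSet → Set
  WeaklyConvexDominating A = WeaklyConvex A × Dominating A

open Graph using (order; Vertex; VertexSet; WeaklyConvexDominating)

-- γ_wcon as a functional relation: the number m is the minimum cardinality
-- of a weakly convex dominating set of G.
infix 4 γwcon_≐_
γwcon_≐_ : Graph → ℕ → Set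
γwcon G ≐ m =
  (Σ[ A ∈ VertexSet G ] WeaklyConvexDominating G A × ∣ A ∣ ≡ m) ×
  (∀ (A : VertexSet G) → WeaklyConvexDominating G A → m ≤ ∣ A ∣)

module _ (G : Graph) (π : Permutation′ (order G)) where
  open Graph G using (_~_; _~?_; ~-sym; ~-irrefl; nonempty)

  -- inj₁ v is the vertex v of G and inj₂ v is its copy v′ in G′.
  PrismAdj : Rel (Vertex G ⊎ Vertex G) 0ℓ
  PrismAdj (inj₁ u) (inj₁ v) = u ~ v
  PrismAdj (inj₂ u) (inj₂ v) = u ~ v
  PrismAdj (inj₁ u) (inj₂ v) = π ⟨$⟩ʳ u ≡ v
  PrismAdj (inj₂ v) (inj₁ u) = π ⟨$⟩ʳ u ≡ v

  private
    adj? : Decidable PrismAdj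
    adj? (inj₁ u) (inj₁ v) = u ~? v
    adj? (inj₂ u) (inj₂ v) = u ~? v
    adj? (inj₁ u) (inj₂ v) = π ⟨$⟩ʳ u ≟ v
    adj? (inj₂ v) (inj₁ u) = π ⟨$⟩ʳ u ≟ v

    adj-sym : ∀ x y → PrismAdj x y → PrismAdj y x
    adj-sym (inj₁ _) (inj₁ _) e = ~-sym e
    adj-sym (inj₂ _) (inj₂ _) e = ~-sym e
    adj-sym (inj₁ _) (inj₂ _) e = e
    adj-sym (inj₂ _) (inj₁ _) e = e

    adj-irrefl : Irreflexive _≡_ PrismAdj
    adj-irrefl {inj₁ _} refl e = ~-irrefl refl e
    adj-irrefl {inj₂ _} refl e = ~-irrefl refl e

  -- The vertices i < order G are those of G, and order G + i is the copy of i.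
  prism : Graph
  prism = record
    { order    = order G + order G
    ; nonempty = nonempty ↑ˡ order G
    ; _~_      = PrismAdj on splitAt (order G)
    ; _~?_     = λ i j → adj? (splitAt (order G) i) (splitAt (order G) j)
    ; ~-sym    = λ {i} {j} → adj-sym (splitAt (order G) i) (splitAt (order G) j)
    ; ~-irrefl = λ { {i} refl → adj-irrefl {splitAt (order G) i} refl }
    }

-- G: join m hubs to m opposite hubs by m² paths of length 3, each the unique geodesic between
-- its ends. A weakly convex dominating set of G meets the interior of each path: if it
-- contains both ends this follows from convexity, and otherwise from domination. Let G also
-- contain a second such layer in which opposite hubs are adjacent, and let π swap the layers.
-- Then in πG two opposite hubs are joined by a path of length 3 through their partners,
-- so the 8m hubs suffice, as πG retracts onto them.
--
-- H: a clique of m centres, each with a pin and three leaves; σ swaps every centre with its pin.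
-- The centres show γwcon(H) ≤ m. In σH the two copies of a centre have distance 2 and only the
-- copies of the pin as common neighbours, so a weakly convex dominating set contains both
-- copies and a pin, or else it needs a vertex for each of the three leaves: γwcon(σH) ≥ 3m.

module Submission where

open import Defs
open import Data.Bool.Base using (Bool; true; false; not)
open import Data.Bool.Properties using (not-involutive; not-¬) renaming (_≟_ to _≟ᵇ_)
open import Data.Empty using () renaming (⊥ to Empty)
open import Data.Fin.Base using (Fin; zero; suc; splitAt)
open import Data.Fin.Permutation using (Permutation′; _⟨$⟩ʳ_)
open import Data.Fin.Properties
  using (_≟_; any?; all?; 0≢1+n; suc-injective; 2↔Bool; *↔×; +↔⊎; splitAt-join)
open import Data.Fin.Subset using (Subset; _∈_; ∣_∣; ⊥; ⊤; ⁅_⁆; _∪_) renaming (_-_ to _∖_)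
open import Data.Fin.Subset.Properties
  using (_∈?_; anySubset?; ∈⊤; ∣⊥∣≡0; ∣⁅x⁆∣≡1; ∉⊥; x∈⁅x⁆; x∈⁅y⁆⇒x≡y; x∈p∪q⁻; x∈p∪q⁺;
         x∈p∧x≢y⇒x∈p-y; x∈p⇒∣p-x∣<∣p∣)
open import Data.Integer.Base using (+_; _-_; _*_; _≥_)
import Data.Integer.Base as ℤ
import Data.Integer.Properties as ℤ
open import Data.List.Base using ([]; _∷_)
open import Data.List.Membership.Propositional using () renaming (_∈_ to _∈ˡ_)
open import Data.List.Relation.Unary.All as All using (All; []; _∷_)
open import Data.List.Relation.Unary.AllPairs using ([]; _∷_)
open import Data.List.Relation.Unary.Any using (here; there)
open import Data.Nat.Base using (ℕ; zero; suc; _+_; _≤_; z≤n; s≤s; s≤s⁻¹)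
import Data.Nat.Base as ℕ
import Data.Nat.Properties as ℕ
open import Data.Nat.Tactic.RingSolver using (solve-∀)
open import Data.Product.Base using (_×_; _,_; proj₁; proj₂; ∃-syntax; Σ-syntax; map₂)
open import Data.Product.Function.NonDependent.Propositional using (_×-↔_)
open import Data.Sum.Base as Sum using (_⊎_; inj₁; inj₂)
open import Data.Sum.Function.Propositional using (_⊎-↔_)
open import Data.Unit.Base using (tt)
open import Data.Vec.Base using ([]; _∷_)
open import Function.Base using (_∘_; _on_; id)
open import Function.Bundles using (_↔_; mk↔ₛ′; module Inverse)
open import Function.Construct.Composition using (_↔-∘_)
open import Function.Construct.Symmetry using (↔-sym)
open import Function.Construct.Identity using (↔-id)
open import Level using (0ℓ)
open import Relation.Binary.Construct.Closure.ReflexiveTransitive as Star using (Star; ε; _◅_; _◅◅_)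
open import Relation.Binary.Core using (Rel)
open import Relation.Binary.Definitions using (Decidable; Symmetric)
open import Relation.Binary.PropositionalEquality
  using (_≡_; _≢_; refl; sym; trans; cong; subst; subst₂)
open import Relation.Nullary using (Dec; yes; no; ¬_; contradiction)
open import Relation.Nullary.Decidable using (map′; _×-dec_; _→-dec_; _⊎-dec_; ¬?)
open import Relation.Unary using (Pred; U)
import Relation.Unary as Unary

-- Least witnesses and cardinalities of finite subsets

least : ∀ {P : Pred ℕ 0ℓ} → Unary.Decidable P → ∀ {n} → P n →
        ∃[ m ] P m × (∀ k → P k → m ≤ k)
least P? {n} Pn with P? 0
... | yes P0 = 0 , P0 , λ _ _ → z≤n
least P? {zero}  Pn | no ¬P0 = contradiction Pn ¬P0
least P? {suc n} Pn | no ¬P0 with least (P? ∘ suc) Pn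
... | m , Pm , min = suc m , Pm , λ where
  zero    P0 → contradiction P0 ¬P0
  (suc k) Pk → s≤s (min k Pk)

injection⇒≤∣p∣ : ∀ {n N} (p : Subset N) (f : Fin n → Fin N) →
  (∀ {i j} → f i ≡ f j → i ≡ j) → (∀ i → f i ∈ p) → n ≤ ∣ p ∣
injection⇒≤∣p∣ {zero}  p f inj f∈ = z≤n
injection⇒≤∣p∣ {suc n} p f inj f∈ = ℕ.≤-trans
  (s≤s (injection⇒≤∣p∣ (p ∖ f zero) (f ∘ suc) (suc-injective ∘ inj)
    λ i → x∈p∧x≢y⇒x∈p-y (f∈ (suc i)) (0≢1+n ∘ sym ∘ inj)))
  (x∈p⇒∣p-x∣<∣p∣ (f∈ zero))

-- Repeated values of `f` merge in the union, so `n` only bounds the cardinality from above.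
image : ∀ {n N} → (Fin n → Fin N) → Subset N
image {zero}  f = ⊥
image {suc n} f = ⁅ f zero ⁆ ∪ image (f ∘ suc)

∈-image⁺ : ∀ {n N} (f : Fin n → Fin N) i → f i ∈ image f
∈-image⁺ f zero    = x∈p∪q⁺ (inj₁ (x∈⁅x⁆ (f zero)))
∈-image⁺ f (suc i) = x∈p∪q⁺ (inj₂ (∈-image⁺ (f ∘ suc) i))

∈-image⁻ : ∀ {n N} (f : Fin n → Fin N) {x} → x ∈ image f → ∃[ i ] x ≡ f i
∈-image⁻ {zero}  f x∈ = contradiction x∈ ∉⊥
∈-image⁻ {suc n} f x∈ with x∈p∪q⁻ ⁅ f zero ⁆ (image (f ∘ suc)) x∈
... | inj₁ x∈f0 = zero , x∈⁅y⁆⇒x≡y (f zero) x∈f0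
... | inj₂ x∈fs with ∈-image⁻ (f ∘ suc) x∈fs
...   | i , x≡ = suc i , x≡

∣p∪q∣≤∣p∣+∣q∣ : ∀ {N} (p q : Subset N) → ∣ p ∪ q ∣ ≤ ∣ p ∣ + ∣ q ∣
∣p∪q∣≤∣p∣+∣q∣ []          []          = z≤n
∣p∪q∣≤∣p∣+∣q∣ (true  ∷ p) (true  ∷ q) =
  s≤s (ℕ.≤-trans (∣p∪q∣≤∣p∣+∣q∣ p q) (ℕ.+-monoʳ-≤ ∣ p ∣ (ℕ.n≤1+n ∣ q ∣)))
∣p∪q∣≤∣p∣+∣q∣ (true  ∷ p) (false ∷ q) = s≤s (∣p∪q∣≤∣p∣+∣q∣ p q)
∣p∪q∣≤∣p∣+∣q∣ (false ∷ p) (true  ∷ q) =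
  ℕ.≤-trans (s≤s (∣p∪q∣≤∣p∣+∣q∣ p q)) (ℕ.≤-reflexive (sym (ℕ.+-suc ∣ p ∣ ∣ q ∣)))
∣p∪q∣≤∣p∣+∣q∣ (false ∷ p) (false ∷ q) = ∣p∪q∣≤∣p∣+∣q∣ p q

∣image∣≤ : ∀ {n N} (f : Fin n → Fin N) → ∣ image f ∣ ≤ n
∣image∣≤ {zero}  {N} f = ℕ.≤-reflexive (∣⊥∣≡0 N)
∣image∣≤ {suc n} f = ℕ.≤-trans (∣p∪q∣≤∣p∣+∣q∣ ⁅ f zero ⁆ (image (f ∘ suc)))
  (ℕ.+-mono-≤ (ℕ.≤-reflexive (∣⁅x⁆∣≡1 (f zero))) (∣image∣≤ (f ∘ suc)))

-- Walks of a given length inside a set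

infixr 5 _∷⟨_⟩_

data WalkIn {V : Set} (_~_ : Rel V 0ℓ) (S : Pred V 0ℓ) : ℕ → Rel V 0ℓ where
  [_]    : ∀ {u} → S u → WalkIn _~_ S 0 u u
  _∷⟨_⟩_ : ∀ {n u v w} → S u → u ~ v → WalkIn _~_ S n v w → WalkIn _~_ S (suc n) u w

mapWalk : ∀ {V W : Set} {R : Rel V 0ℓ} {R′ : Rel W 0ℓ} {S : Pred V 0ℓ} {S′ : Pred W 0ℓ}
  (f : V → W) → (∀ {u} → S u → S′ (f u)) → (∀ {u v} → R u v → R′ (f u) (f v)) →
  ∀ {n u v} → WalkIn R S n u v → WalkIn R′ S′ n (f u) (f v)
mapWalk f s r [ Su ]          = [ s Su ]
mapWalk f s r (Su ∷⟨ e ⟩ w) = s Su ∷⟨ r e ⟩ mapWalk f s r w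

-- Steps whose ends `f` identifies are dropped, so the length can only go down.
contractWalk : ∀ {V W : Set} {R : Rel V 0ℓ} {R′ : Rel W 0ℓ} {S : Pred W 0ℓ} (f : V → W) →
  (∀ u → S (f u)) → (∀ {u v} → R u v → f u ≡ f v ⊎ R′ (f u) (f v)) →
  ∀ {n u v} → WalkIn R U n u v → ∃[ m ] m ≤ n × WalkIn R′ S m (f u) (f v)
contractWalk f s r ([_] {u} _) = 0 , z≤n , [ s u ]
contractWalk {R′ = R′} {S} f s r (_∷⟨_⟩_ {u = u} {w = w} _ e p) with contractWalk {R′ = R′} {S} f s r p | r e
... | m , m≤n , q | inj₁ fu≡fv = m , ℕ.m≤n⇒m≤1+n m≤n , subst (λ x → WalkIn R′ S m x (f w)) (sym fu≡fv) q
... | m , m≤n , q | inj₂ e′    = suc m , s≤s m≤n , s u ∷⟨ e′ ⟩ q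

-- Geodesics, and existence of the minimum

module Geodesics (Γ : Graph) where
  open Graph Γ

  fromWalk : ∀ {S : Pred Vertex 0ℓ} {u v} (p : Walk u v) → All S (vertices p) →
             WalkIn _~_ S (len p) u v
  fromWalk ε       (s ∷ []) = [ s ]
  fromWalk (e ◅ p) (s ∷ ss) = s ∷⟨ e ⟩ fromWalk p ss

  toWalk : ∀ {S : Pred Vertex 0ℓ} {n u v} → WalkIn _~_ S n u v →
           Σ[ p ∈ Walk u v ] len p ≡ n × All S (vertices p)
  toWalk [ s ]          = ε , refl , s ∷ []
  toWalk (s ∷⟨ e ⟩ w) with toWalk w
  ... | p , refl , ss = e ◅ p , refl , s ∷ ss

  walkIn? : ∀ {S : Pred Vertex 0ℓ} → Unary.Decidable S → ∀ n u v → Dec (WalkIn _~_ S n u v)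
  walkIn? S? zero    u v = map′ (λ { (refl , s) → [ s ] }) (λ { [ s ] → refl , s }) (u ≟ v ×-dec S? u)
  walkIn? S? (suc n) u v = map′
    (λ { (s , _ , e , w) → s ∷⟨ e ⟩ w })
    (λ { (s ∷⟨ e ⟩ w) → s , _ , e , w })
    (S? u ×-dec any? λ x → (u ~? x) ×-dec walkIn? S? n x v)

  -- Compares with all walks, while `IsShortestPath` compares with paths only; `minimal⇒path`
  -- reconciles the two.
  Minimal : ∀ {u v} → Walk u v → Set
  Minimal {u} {v} p = ∀ (q : Walk u v) → len p ≤ len q

  suffix : ∀ {u v x} (w : Walk u v) → x ∈ˡ vertices w → Σ[ q ∈ Walk x v ] len q ≤ len w
  suffix ε       (here refl) = ε , z≤n
  suffix (e ◅ w) (here refl) = e ◅ w , ℕ.≤-refl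
  suffix (e ◅ w) (there x∈)  = map₂ ℕ.m≤n⇒m≤1+n (suffix w x∈)

  -- If the first vertex occurred again, the suffix from that occurrence would be a strictly shorter
  -- walk.
  minimal⇒path : ∀ {u v} (p : Walk u v) → Minimal p → IsPath p
  minimal⇒path ε       min = [] ∷ []
  minimal⇒path {u} (e ◅ w) min =
    All.tabulate u∉w ∷ minimal⇒path w (λ q → s≤s⁻¹ (min (e ◅ q)))
    where
    u∉w : ∀ {x} → x ∈ˡ vertices w → u ≢ x
    u∉w x∈ refl with suffix w x∈
    ... | q , q≤w = ℕ.1+n≰n (ℕ.≤-trans (min q) q≤w)

  module _ (connected : Connected) where

    geodesic : ∀ u v → Σ[ p ∈ Walk u v ] Minimal p
    geodesic u v with least (λ n → walkIn? {U} (λ _ → yes tt) n u v)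
                            (fromWalk (connected u v) (All.tabulate _))
    ... | d , w , min with toWalk w
    ...   | p , refl , _ = p , λ q → min (len q) (fromWalk q (All.tabulate _))

    dist : Vertex → Vertex → ℕ
    dist u v = len (proj₁ (geodesic u v))

    dist≤ : ∀ {S n u v} → WalkIn _~_ S n u v → dist u v ≤ n
    dist≤ {u = u} {v} w with toWalk w
    ... | p , refl , _ = proj₂ (geodesic u v) p

    -- A form of weak convexity that a finite search decides: the length is fixed to the distance,
    -- and no quantifier over walks remains.
    Isometric : VertexSet → Set
    Isometric A = ∀ u v → u ∈ A → v ∈ A → WalkIn _~_ (_∈ A) (dist u v) u v

    isometric? : Unary.Decidable Isometric
    isometric? A = all? λ u → all? λ v →
      (u ∈? A) →-dec ((v ∈? A) →-dec walkIn? (_∈? A) (dist u v) u v)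

    isometric⇒weaklyConvex : ∀ {A} → Isometric A → WeaklyConvex A
    isometric⇒weaklyConvex iso u v u∈A v∈A with toWalk (iso u v u∈A v∈A)
    ... | p , p≡d , p⊆A = p , (minimal⇒path p min , λ q _ → min q) , p⊆A
      where
      min : Minimal p
      min q = subst (_≤ len q) (sym p≡d) (proj₂ (geodesic u v) q)

    weaklyConvex⇒isometric : ∀ {A} → WeaklyConvex A → Isometric A
    weaklyConvex⇒isometric {A} wc u v u∈A v∈A with wc u v u∈A v∈A | geodesic u v
    ... | p , (_ , short) , p⊆A | g , min =
      -- The geodesic `g` is itself a path, so `p` is no longer than `g`.
      subst (λ n → WalkIn _~_ (_∈ A) n u v)
            (ℕ.≤-antisym (short g (minimal⇒path g min)) (min p)) (fromWalk p p⊆A)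

    dominating? : Unary.Decidable Dominating
    dominating? A = all? λ v → (v ∈? A) ⊎-dec any? λ u → (u ∈? A) ×-dec (v ~? u)

    weaklyConvexDominating? : Unary.Decidable WeaklyConvexDominating
    weaklyConvexDominating? A =
      map′ isometric⇒weaklyConvex weaklyConvex⇒isometric (isometric? A) ×-dec dominating? A

    -- The set of all vertices is weakly convex and dominating, so some cardinality is attained;
    -- decidability then yields the least one.
    γwcon-exists : ∃[ m ] (γwcon Γ ≐ m)
    γwcon-exists with least
      (λ n → anySubset? λ A → weaklyConvexDominating? A ×-dec (∣ A ∣ ℕ.≟ n))
      (⊤ , (isometric⇒weaklyConvex (λ u v _ _ → fromWalk (proj₁ (geodesic u v)) (All.tabulate λ _ → ∈⊤))
           , λ _ → inj₁ ∈⊤) , refl)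
    ... | m , attained , min = m , attained , λ A A-wcd → min ∣ A ∣ (A , A-wcd , refl)

-- Graphs on an enumerated vertex type

-- Lets adjacency be analysed by pattern matching on a structured type `V` in place of `Fin order`.
record Presentation (Γ : Graph) : Set₁ where
  open Graph Γ using (order; _~_)
  field
    V     : Set
    enum  : Fin order ↔ V
    Adj   : Rel V 0ℓ
  open Inverse enum public
    using (to; from) renaming (strictlyInverseˡ to to∘from; strictlyInverseʳ to from∘to)
  field
    ~⇒Adj : ∀ {u v} → u ~ v → Adj (to u) (to v)
    Adj⇒~ : ∀ {x y} → Adj x y → from x ~ from y

module _ {V : Set} {n} (enum : Fin n ↔ V) (v₀ : V) {Adj : Rel V 0ℓ}
         (adj? : Decidable Adj) (adj-sym : Symmetric Adj) (adj-irrefl : ∀ x → ¬ Adj x x) where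
  open Inverse enum

  graphOn : Graph
  graphOn = record
    { order    = n
    ; nonempty = from v₀
    ; _~_      = Adj on to
    ; _~?_     = λ u v → adj? (to u) (to v)
    ; ~-sym    = adj-sym
    ; ~-irrefl = λ { {u} refl → adj-irrefl (to u) }
    }

  graphOn-presentation : Presentation graphOn
  graphOn-presentation = record
    { V     = V
    ; enum  = enum
    ; Adj   = Adj
    ; ~⇒Adj = id
    ; Adj⇒~ = subst₂ Adj (sym (strictlyInverseˡ _)) (sym (strictlyInverseˡ _))
    }

module _ {Γ : Graph} (P : Presentation Γ) (π : Permutation′ (Graph.order Γ))
         {f : Presentation.V P → Presentation.V P}
         (π≗f : ∀ u → Presentation.to P (π ⟨$⟩ʳ u) ≡ f (Presentation.to P u)) where
  open Presentation P

  PrismAdjOn : Rel (V ⊎ V) 0ℓ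
  PrismAdjOn (inj₁ x) (inj₁ y) = Adj x y
  PrismAdjOn (inj₂ x) (inj₂ y) = Adj x y
  PrismAdjOn (inj₁ x) (inj₂ y) = f x ≡ y
  PrismAdjOn (inj₂ y) (inj₁ x) = f x ≡ y

  private
    encode : ∀ {x y} → f x ≡ y → π ⟨$⟩ʳ from x ≡ from y
    encode {x} refl = trans (sym (from∘to _))
      (cong from (trans (π≗f (from x)) (cong f (to∘from x))))

    decode : ∀ {u v} → π ⟨$⟩ʳ u ≡ v → f (to u) ≡ to v
    decode refl = sym (π≗f _)

    decodeAdj : ∀ u v → PrismAdj Γ π u v → PrismAdjOn (Sum.map to to u) (Sum.map to to v)
    decodeAdj (inj₁ _) (inj₁ _) = ~⇒Adj
    decodeAdj (inj₂ _) (inj₂ _) = ~⇒Adj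
    decodeAdj (inj₁ _) (inj₂ _) = decode
    decodeAdj (inj₂ _) (inj₁ _) = decode

    encodeAdj : ∀ x y → PrismAdjOn x y → PrismAdj Γ π (Sum.map from from x) (Sum.map from from y)
    encodeAdj (inj₁ _) (inj₁ _) = Adj⇒~
    encodeAdj (inj₂ _) (inj₂ _) = Adj⇒~
    encodeAdj (inj₁ _) (inj₂ _) = encode
    encodeAdj (inj₂ _) (inj₁ _) = encode

  prism-presentation : Presentation (prism Γ π)
  prism-presentation = record
    { V     = V ⊎ V
    ; enum  = (enum ⊎-↔ enum) ↔-∘ +↔⊎
    ; Adj   = PrismAdjOn
    ; ~⇒Adj = λ {u} {v} → decodeAdj (splitAt n u) (splitAt n v)
    ; Adj⇒~ = λ {x} {y} e → subst₂ (PrismAdj Γ π)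
        (sym (splitAt-join n n (Sum.map from from x)))
        (sym (splitAt-join n n (Sum.map from from y))) (encodeAdj x y e)
    }
    where n = Graph.order Γ

  -- Each copy is connected in itself, and the matching edge at `x` links the two.
  prism-connected : (∀ x y → Star Adj x y) → ∀ x y → Star PrismAdjOn x y
  prism-connected conn (inj₁ x) (inj₁ y) = Star.gmap inj₁ id (conn x y)
  prism-connected conn (inj₂ x) (inj₂ y) = Star.gmap inj₂ id (conn x y)
  prism-connected conn (inj₁ x) (inj₂ y) = refl ◅ Star.gmap inj₂ id (conn (f x) y)
  prism-connected conn (inj₂ y) (inj₁ x) = Star.gmap inj₂ id (conn y (f x)) ◅◅ refl ◅ ε

permutationOn : ∀ {V : Set} {n} → Fin n ↔ V → V ↔ V → Permutation′ n
permutationOn enum φ = ↔-sym enum ↔-∘ (φ ↔-∘ enum)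

-- Lower bounds by labels, upper bounds by retractions

module Bounds {Γ : Graph} (P : Presentation Γ)
              (connectedOn : ∀ x y → Star (Presentation.Adj P) x y) where
  open Presentation P
  open Graph Γ using (Vertex; VertexSet; WeaklyConvex; Dominating; WeaklyConvexDominating; Walk; Connected)
  open Geodesics Γ

  connected : Connected
  connected u v = subst₂ Walk (from∘to u) (from∘to v)
    (Star.gmap from Adj⇒~ (connectedOn (to u) (to v)))

  infix 4 _∈ᵛ_
  _∈ᵛ_ : V → VertexSet → Set
  x ∈ᵛ A = from x ∈ A

  _∈ᵛ?_ : ∀ x A → Dec (x ∈ᵛ A)
  x ∈ᵛ? A = from x ∈? A

  to-∈ᵛ : ∀ {A u} → u ∈ A → to u ∈ᵛ A
  to-∈ᵛ {A} {u} = subst (_∈ A) (sym (from∘to u))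

  dominatedOn : ∀ {A} → Dominating A → ∀ x → x ∈ᵛ A ⊎ (∃[ y ] y ∈ᵛ A × Adj x y)
  dominatedOn dom x with dom (from x)
  ... | inj₁ x∈A = inj₁ x∈A
  ... | inj₂ (u , u∈A , x~u) =
    inj₂ (to u , to-∈ᵛ u∈A , subst (λ z → Adj z (to u)) (to∘from x) (~⇒Adj x~u))

  -- The length `m` is the distance, which the given walk bounds. An explicit short walk thus leaves
  -- only short walks inside `A` to be examined.
  convexOn : ∀ {A} → WeaklyConvex A → ∀ {n x y} → x ∈ᵛ A → y ∈ᵛ A →
             WalkIn Adj U n x y → ∃[ m ] m ≤ n × WalkIn Adj (_∈ᵛ A) m x y
  convexOn {A} wc {n} {x} {y} x∈A y∈A w =
    dist connected (from x) (from y) ,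
    dist≤ connected (mapWalk {S = U} {S′ = U} from _ Adj⇒~ w) ,
    subst₂ (WalkIn Adj (_∈ᵛ A) _) (to∘from x) (to∘from y)
      (mapWalk to to-∈ᵛ ~⇒Adj (weaklyConvex⇒isometric connected wc (from x) (from y) x∈A y∈A))

  -- Choose a vertex of `A` for every label; vertices with distinct labels are distinct.
  γ≥-by-labels : ∀ {n g} {I : Set} → Fin n ↔ I → (κ : V → I) →
    (∀ A → WeaklyConvexDominating A → ∀ i → ∃[ x ] x ∈ᵛ A × κ x ≡ i) →
    γwcon Γ ≐ g → n ≤ g
  γ≥-by-labels {n} {I = I} enumI κ hit ((A , A-wcd , refl) , _) = injection⇒≤∣p∣ A pick pick-inj
    (λ i → proj₁ (proj₂ (hit′ i)))
    where
    module I = Inverse enumI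
    hit′ : ∀ i → ∃[ x ] x ∈ᵛ A × κ x ≡ I.to i
    hit′ i = hit A A-wcd (I.to i)
    pick : Fin n → Vertex
    pick i = from (proj₁ (hit′ i))
    label : Vertex → Fin n
    label u = I.from (κ (to u))
    label-pick : ∀ i → label (pick i) ≡ i
    label-pick i = trans (cong I.from (trans (cong κ (to∘from _)) (proj₂ (proj₂ (hit′ i)))))
                         (I.strictlyInverseʳ i)
    pick-inj : ∀ {i j} → pick i ≡ pick j → i ≡ j
    pick-inj {i} {j} eq = trans (sym (label-pick i)) (trans (cong label eq) (label-pick j))

  -- A retract of a graph (adjacent vertices may be identified) is isometric, hence weakly convex.
  γ≤-by-retraction : ∀ {n g} {I : Set} → Fin n ↔ I → (ι : I → V) (ρ : V → I) →
    (∀ i → ρ (ι i) ≡ i) →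
    (∀ {x y} → Adj x y → ρ x ≡ ρ y ⊎ Adj (ι (ρ x)) (ι (ρ y))) →
    (∀ x → ∃[ i ] (x ≡ ι i ⊎ Adj x (ι i))) →
    γwcon Γ ≐ g → g ≤ n
  γ≤-by-retraction {n} {I = I} enumI ι ρ ρι nonexp dom (_ , least) =
    ℕ.≤-trans (least A (isometric⇒weaklyConvex connected iso , A-dom)) (∣image∣≤ list)
    where
    module I = Inverse enumI
    list : Fin n → Vertex
    list i = from (ι (I.to i))

    A : VertexSet
    A = image list

    ι∈A : ∀ i → ι i ∈ᵛ A
    ι∈A i = subst (λ j → ι j ∈ᵛ A) (I.strictlyInverseˡ i) (∈-image⁺ list (I.from i))

    r : Vertex → Vertex
    r u = from (ι (ρ (to u)))

    r-fixes : ∀ {u} → u ∈ A → r u ≡ u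
    r-fixes u∈A with ∈-image⁻ list u∈A
    ... | i , refl = cong (from ∘ ι) (trans (cong ρ (to∘from _)) (ρι (I.to i)))

    iso : Isometric connected A
    iso u v u∈A v∈A with contractWalk {S = _∈ A} r (λ x → ι∈A (ρ (to x)))
        (λ e → Sum.map (cong (from ∘ ι)) Adj⇒~ (nonexp (~⇒Adj e)))
        (fromWalk {S = U} (proj₁ (geodesic connected u v)) (All.tabulate _))
    -- The image of a geodesic under `r` keeps its ends and lies in `A`; being no longer than the
    -- distance, it has exactly that length.
    ... | m , m≤d , w = subst (λ k → WalkIn _ (_∈ A) k u v) (ℕ.≤-antisym m≤d (dist≤ connected w′)) w′
      where
      w′ : WalkIn _ (_∈ A) m u v
      w′ = subst₂ (WalkIn _ (_∈ A) m) (r-fixes u∈A) (r-fixes v∈A) w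

    A-dom : Dominating A
    A-dom v with dom (to v)
    ... | i , inj₁ v≡ιi = inj₁ (subst (_∈ A) (trans (cong from (sym v≡ιi)) (from∘to v)) (ι∈A i))
    ... | i , inj₂ v~ιi = inj₂ (from (ι i) , ι∈A i ,
      subst (λ x → Graph._~_ Γ x (from (ι i))) (from∘to v) (Adj⇒~ v~ιi))

-- A graph whose prism has a much smaller γwcon

pattern hub i   = inj₁ i
pattern mid i j = inj₂ (i , j)

-- In (q , s , x), q is the layer (false is layer 1, true is layer 2) and s the side of the
-- bipartition. In mid i j the first index is that of the adjacent hub, so that the path from
-- hub i on side s to hub j on the other side runs through mid i j and then mid j i.
module GridGraph (n : ℕ) where

  m : ℕ
  m = suc n

  V : Set
  V = Bool × Bool × (Fin m ⊎ Fin m × Fin m)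

  -- Between hubs, the first disjunct is the complete bipartite graph of layer 2, the second the
  -- bridges that connect the layers. Bridges exist on side `false` only: on both sides they would
  -- give opposite hubs of layer 1 a second path of length 3, through layer 2.
  Adj : Rel V 0ℓ
  Adj (q , s , hub i)   (q′ , s′ , hub j)   =
    (q ≡ true × q′ ≡ true × s′ ≡ not s) ⊎ (q′ ≡ not q × s ≡ false × s′ ≡ false × i ≡ j)
  Adj (q , s , hub i)   (q′ , s′ , mid k l) = q ≡ q′ × s ≡ s′ × i ≡ k
  Adj (q , s , mid k l) (q′ , s′ , hub i)   = q ≡ q′ × s ≡ s′ × i ≡ k
  Adj (q , s , mid i j) (q′ , s′ , mid k l) = q ≡ q′ × s′ ≡ not s × i ≡ l × j ≡ k

  adj? : Decidable Adj
  adj? (q , s , hub i)   (q′ , s′ , hub j)   =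
    (q ≟ᵇ true ×-dec q′ ≟ᵇ true ×-dec s′ ≟ᵇ not s) ⊎-dec
    (q′ ≟ᵇ not q ×-dec s ≟ᵇ false ×-dec s′ ≟ᵇ false ×-dec i ≟ j)
  adj? (q , s , hub i)   (q′ , s′ , mid k l) = q ≟ᵇ q′ ×-dec s ≟ᵇ s′ ×-dec i ≟ k
  adj? (q , s , mid k l) (q′ , s′ , hub i)   = q ≟ᵇ q′ ×-dec s ≟ᵇ s′ ×-dec i ≟ k
  adj? (q , s , mid i j) (q′ , s′ , mid k l) =
    q ≟ᵇ q′ ×-dec s′ ≟ᵇ not s ×-dec i ≟ l ×-dec j ≟ k

  adj-sym : Symmetric Adj
  adj-sym {_ , s , hub _} {_ , _ , hub _} (inj₁ (refl , refl , refl)) =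
    inj₁ (refl , refl , sym (not-involutive s))
  adj-sym {q , _ , hub _} {_ , _ , hub _} (inj₂ (refl , refl , refl , refl)) =
    inj₂ (sym (not-involutive q) , refl , refl , refl)
  adj-sym {_ , _ , hub _}   {_ , _ , mid _ _} (refl , refl , refl) = refl , refl , refl
  adj-sym {_ , _ , mid _ _} {_ , _ , hub _}   (refl , refl , refl) = refl , refl , refl
  adj-sym {_ , s , mid _ _} {_ , _ , mid _ _} (refl , refl , refl , refl) =
    refl , sym (not-involutive s) , refl , refl

  adj-irrefl : ∀ x → ¬ Adj x x
  adj-irrefl (_ , s , hub _) (inj₁ (_ , _ , s≡not-s)) = not-¬ refl s≡not-s
  adj-irrefl (q , _ , hub _) (inj₂ (q≡not-q , _))     = not-¬ refl q≡not-q
  adj-irrefl (_ , s , mid _ _) (_ , s≡not-s , _)      = not-¬ refl s≡not-s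

  abstract
    enum : Fin (2 ℕ.* (2 ℕ.* (m + m ℕ.* m))) ↔ V
    enum = (2↔Bool ×-↔ ((2↔Bool ×-↔ ((↔-id (Fin m) ⊎-↔ *↔×) ↔-∘ +↔⊎)) ↔-∘ *↔×)) ↔-∘ *↔×

  root : V
  root = true , false , hub zero

  G : Graph
  G = graphOn enum root adj? adj-sym adj-irrefl

  presentation : Presentation G
  presentation = graphOn-presentation enum root adj? adj-sym adj-irrefl

  second-layer-root : ∀ s i → Star Adj (true , s , hub i) root
  second-layer-root true  i = inj₁ (refl , refl , refl) ◅ ε
  second-layer-root false i = _◅_ {j = true , true , hub zero}
    (inj₁ (refl , refl , refl)) (inj₁ (refl , refl , refl) ◅ ε)

  bridge-root : ∀ i → Star Adj (false , false , hub i) root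
  bridge-root i = _◅_ {j = true , false , hub i}
    (inj₂ (refl , refl , refl , refl)) (second-layer-root false i)

  hub-root : ∀ q s i → Star Adj (q , s , hub i) root
  hub-root true  s     i = second-layer-root s i
  hub-root false false i = bridge-root i
  -- No bridge starts here, so the walk first crosses to `hub zero` on side `false`.
  hub-root false true  i =
    _◅_ {j = false , true , mid i zero} (refl , refl , refl)
      (_◅_ {j = false , false , mid zero i} (refl , refl , refl , refl)
        (_◅_ {j = false , false , hub zero} (refl , refl , refl) (bridge-root zero)))

  to-root : ∀ x → Star Adj x root
  to-root (q , s , hub i)   = hub-root q s i
  to-root (q , s , mid i j) = _◅_ {j = q , s , hub i} (refl , refl , refl) (hub-root q s i)

  connectedOn : ∀ x y → Star Adj x y
  connectedOn x y = to-root x ◅◅ Star.reverse adj-sym (to-root y)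

  open Bounds presentation connectedOn public

  -- The two mids between a pair of hubs share a label; the values on hubs are junk.
  label : V → Fin m × Fin m
  label (_ , _     , hub i)   = i , i
  label (_ , false , mid i j) = i , j
  label (_ , true  , mid j i) = i , j

  -- A mid has just two neighbours: the other mid of its path and its hub.
  dominated-mid : ∀ {A} → Graph.Dominating G A → ∀ s i j →
    (false , s , mid i j) ∈ᵛ A ⊎ (false , not s , mid j i) ∈ᵛ A ⊎ (false , s , hub i) ∈ᵛ A
  dominated-mid dom s i j with dominatedOn dom (false , s , mid i j)
  ... | inj₁ mid∈A = inj₁ mid∈A
  ... | inj₂ ((_ , _ , mid _ _) , mid∈A , refl , refl , refl , refl) = inj₂ (inj₁ mid∈A)
  ... | inj₂ ((_ , _ , hub _)   , hub∈A , refl , refl , refl)        = inj₂ (inj₂ hub∈A)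

  -- The starting hub has no bridge, so the walk must enter a mid; from there three steps suffice
  -- only when it follows the path straight to its other end.
  short-walk : ∀ {A k i j} → k ≤ 3 →
    WalkIn Adj (_∈ᵛ A) k (false , true , hub j) (false , false , hub i) →
    (false , true , mid j i) ∈ᵛ A
  short-walk _ (_∷⟨_⟩_ {v = _ , _ , hub _} _ (inj₁ (() , _)) _)
  short-walk _ (_∷⟨_⟩_ {v = _ , _ , hub _} _ (inj₂ (_ , () , _)) _)
  short-walk _ (_∷⟨_⟩_ {v = _ , _ , mid _ _} _ (refl , refl , refl) (_ ∷⟨ _ , () , _ ⟩ [ _ ]))
  short-walk _ (_∷⟨_⟩_ {v = _ , _ , mid _ _} _ (refl , refl , refl)
                (_∷⟨_⟩_ {v = _ , _ , hub _} _ (refl , refl , refl) (_ ∷⟨ inj₁ (() , _) ⟩ [ _ ])))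
  short-walk _ (_∷⟨_⟩_ {v = _ , _ , mid _ _} _ (refl , refl , refl)
                (_∷⟨_⟩_ {v = _ , _ , hub _} _ (refl , refl , refl) (_ ∷⟨ inj₂ (_ , () , _) ⟩ [ _ ])))
  short-walk _ (_∷⟨_⟩_ {v = _ , _ , mid _ _} _ (refl , refl , refl)
                (_∷⟨_⟩_ {v = _ , _ , mid _ _} mid∈A (refl , refl , refl , refl)
                  (_ ∷⟨ refl , refl , refl ⟩ [ _ ]))) = mid∈A
  short-walk (s≤s (s≤s (s≤s ()))) (_ ∷⟨ _ ⟩ _ ∷⟨ _ ⟩ _ ∷⟨ _ ⟩ _ ∷⟨ _ ⟩ _)

  path₃ : ∀ i j → WalkIn Adj U 3 (false , true , hub j) (false , false , hub i)
  path₃ i j =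
    _∷⟨_⟩_ {v = false , true , mid j i} _ (refl , refl , refl)
      (_∷⟨_⟩_ {v = false , false , mid i j} _ (refl , refl , refl , refl)
        (_ ∷⟨ refl , refl , refl ⟩ [ _ ]))

  γG≥m² : ∀ {g} → γwcon G ≐ g → m ℕ.* m ≤ g
  γG≥m² = γ≥-by-labels *↔× label hit
    where
    hit : ∀ A → Graph.WeaklyConvexDominating G A → ∀ ij → ∃[ x ] x ∈ᵛ A × label x ≡ ij
    hit A (wc , dom) (i , j) with dominated-mid dom false i j | dominated-mid dom true j i
    ... | inj₁ ij∈A        | _                = (false , false , mid i j) , ij∈A , refl
    ... | inj₂ (inj₁ ji∈A) | _                = (false , true  , mid j i) , ji∈A , refl
    ... | inj₂ (inj₂ _)    | inj₁ ji∈A        = (false , true  , mid j i) , ji∈A , refl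
    ... | inj₂ (inj₂ _)    | inj₂ (inj₁ ij∈A) = (false , false , mid i j) , ij∈A , refl
    -- Domination alone gives only the two end hubs here; convexity then puts the interior of their
    -- unique geodesic into `A`.
    ... | inj₂ (inj₂ i∈A)  | inj₂ (inj₂ j∈A)  with convexOn wc j∈A i∈A (path₃ i j)
    ...   | _ , k≤3 , w = (false , true , mid j i) , short-walk k≤3 w , refl

  -- Upper bound for the prism of the grid graph

  swapLayers : V ↔ V
  swapLayers = mk↔ₛ′ (λ (q , x) → not q , x) (λ (q , x) → not q , x)
    (λ (q , x) → cong (_, x) (not-involutive q)) (λ (q , x) → cong (_, x) (not-involutive q))

  π : Permutation′ (Graph.order G)
  π = permutationOn enum swapLayers

  prismPresentation : Presentation (prism G π)
  prismPresentation = prism-presentation presentation π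
    {f = Inverse.to swapLayers} λ u → Inverse.strictlyInverseˡ enum _

  prismConnected : ∀ x y → Star (Presentation.Adj prismPresentation) x y
  prismConnected = prism-connected presentation π _ connectedOn

  module PrismBounds = Bounds prismPresentation prismConnected

  hubAt : Bool × Bool × Fin m → V
  hubAt (q , s , i) = q , s , hub i

  Hub : Set
  Hub = (Bool × Bool × Fin m) ⊎ (Bool × Bool × Fin m)

  ι : Hub → V ⊎ V
  ι = Sum.map hubAt hubAt

  -- In the prism, layer 1 of either copy of G is matched with layer 2 of the other copy.
  -- Each such pair of layers is retracted onto its hubs by sending all mids into layer 2,
  -- the one in which opposite hubs are adjacent.
  ρ : V ⊎ V → Hub
  ρ (inj₁ (q     , s , hub i))   = inj₁ (q , s , i)
  ρ (inj₂ (q     , s , hub i))   = inj₂ (q , s , i)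
  ρ (inj₁ (false , s , mid i _)) = inj₂ (true , s , i)
  ρ (inj₁ (true  , s , mid i _)) = inj₁ (true , s , i)
  ρ (inj₂ (false , s , mid i _)) = inj₁ (true , s , i)
  ρ (inj₂ (true  , s , mid i _)) = inj₂ (true , s , i)

  ρι : ∀ i → ρ (ι i) ≡ i
  ρι (inj₁ _) = refl
  ρι (inj₂ _) = refl

  PrismAdjᵛ : Rel (V ⊎ V) 0ℓ
  PrismAdjᵛ = Presentation.Adj prismPresentation

  -- A hub-mid edge becomes a matching edge in layer 1 and collapses in layer 2. A mid-mid edge
  -- becomes an edge between opposite hubs of layer 2. Matching edges are kept between hubs and
  -- collapse between mids.
  ρ-nonexpansive : ∀ x y → PrismAdjᵛ x y → ρ x ≡ ρ y ⊎ PrismAdjᵛ (ι (ρ x)) (ι (ρ y))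
  ρ-nonexpansive (inj₁ (_ , _ , hub _))       (inj₁ (_ , _ , hub _))   e = inj₂ e
  ρ-nonexpansive (inj₂ (_ , _ , hub _))       (inj₂ (_ , _ , hub _))   e = inj₂ e
  ρ-nonexpansive (inj₁ (false , _ , hub _))   (inj₁ (_ , _ , mid _ _)) (refl , refl , refl) = inj₂ refl
  ρ-nonexpansive (inj₁ (true  , _ , hub _))   (inj₁ (_ , _ , mid _ _)) (refl , refl , refl) = inj₁ refl
  ρ-nonexpansive (inj₂ (false , _ , hub _))   (inj₂ (_ , _ , mid _ _)) (refl , refl , refl) = inj₂ refl
  ρ-nonexpansive (inj₂ (true  , _ , hub _))   (inj₂ (_ , _ , mid _ _)) (refl , refl , refl) = inj₁ refl
  ρ-nonexpansive (inj₁ (false , _ , mid _ _)) (inj₁ (_ , _ , hub _))   (refl , refl , refl) = inj₂ refl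
  ρ-nonexpansive (inj₁ (true  , _ , mid _ _)) (inj₁ (_ , _ , hub _))   (refl , refl , refl) = inj₁ refl
  ρ-nonexpansive (inj₂ (false , _ , mid _ _)) (inj₂ (_ , _ , hub _))   (refl , refl , refl) = inj₂ refl
  ρ-nonexpansive (inj₂ (true  , _ , mid _ _)) (inj₂ (_ , _ , hub _))   (refl , refl , refl) = inj₁ refl
  ρ-nonexpansive (inj₁ (false , _ , mid _ _)) (inj₁ (_ , _ , mid _ _)) (refl , refl , refl , refl) =
    inj₂ (inj₁ (refl , refl , refl))
  ρ-nonexpansive (inj₁ (true  , _ , mid _ _)) (inj₁ (_ , _ , mid _ _)) (refl , refl , refl , refl) =
    inj₂ (inj₁ (refl , refl , refl))
  ρ-nonexpansive (inj₂ (false , _ , mid _ _)) (inj₂ (_ , _ , mid _ _)) (refl , refl , refl , refl) =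
    inj₂ (inj₁ (refl , refl , refl))
  ρ-nonexpansive (inj₂ (true  , _ , mid _ _)) (inj₂ (_ , _ , mid _ _)) (refl , refl , refl , refl) =
    inj₂ (inj₁ (refl , refl , refl))
  ρ-nonexpansive (inj₁ (_ , _ , hub _))       (inj₂ _) refl = inj₂ refl
  ρ-nonexpansive (inj₁ (false , _ , mid _ _)) (inj₂ _) refl = inj₁ refl
  ρ-nonexpansive (inj₁ (true  , _ , mid _ _)) (inj₂ _) refl = inj₁ refl
  ρ-nonexpansive (inj₂ _) (inj₁ (_ , _ , hub _))       refl = inj₂ refl
  ρ-nonexpansive (inj₂ _) (inj₁ (false , _ , mid _ _)) refl = inj₁ refl
  ρ-nonexpansive (inj₂ _) (inj₁ (true  , _ , mid _ _)) refl = inj₁ refl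

  hubs-dominate : ∀ x → ∃[ i ] (x ≡ ι i ⊎ PrismAdjᵛ x (ι i))
  hubs-dominate (inj₁ (q , s , hub i))   = inj₁ (q , s , i) , inj₁ refl
  hubs-dominate (inj₂ (q , s , hub i))   = inj₂ (q , s , i) , inj₁ refl
  hubs-dominate (inj₁ (q , s , mid i _)) = inj₁ (q , s , i) , inj₂ (refl , refl , refl)
  hubs-dominate (inj₂ (q , s , mid i _)) = inj₂ (q , s , i) , inj₂ (refl , refl , refl)

  γπG≤8m : ∀ {g} → γwcon prism G π ≐ g → g ≤ 2 ℕ.* (2 ℕ.* m) + 2 ℕ.* (2 ℕ.* m)
  γπG≤8m = PrismBounds.γ≤-by-retraction ((enumHub ⊎-↔ enumHub) ↔-∘ +↔⊎) ι ρ ρι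
    (λ {x} {y} → ρ-nonexpansive x y) hubs-dominate
    where
    enumHub : Fin (2 ℕ.* (2 ℕ.* m)) ↔ (Bool × Bool × Fin m)
    enumHub = (2↔Bool ×-↔ ((2↔Bool ×-↔ ↔-id (Fin m)) ↔-∘ *↔×)) ↔-∘ *↔×

-- A graph whose prism has at least three times its γwcon

pattern centre = zero
pattern pin    = suc zero
pattern leaf t = suc (suc t)

module CorollaGraph (n : ℕ) where

  m : ℕ
  m = suc n

  V : Set
  V = Fin m × Fin 5

  Adj : Rel V 0ℓ
  Adj (i , centre) (j , centre) = i ≢ j
  Adj (i , centre) (j , suc _)  = i ≡ j
  Adj (i , suc _)  (j , centre) = i ≡ j
  Adj (_ , suc _)  (_ , suc _)  = Empty

  adj? : Decidable Adj
  adj? (i , centre) (j , centre) = ¬? (i ≟ j)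
  adj? (i , centre) (j , suc _)  = i ≟ j
  adj? (i , suc _)  (j , centre) = i ≟ j
  adj? (_ , suc _)  (_ , suc _)  = no λ ()

  adj-sym : Symmetric Adj
  adj-sym {_ , centre} {_ , centre} i≢j = i≢j ∘ sym
  adj-sym {_ , centre} {_ , suc _}  i≡j = sym i≡j
  adj-sym {_ , suc _}  {_ , centre} i≡j = sym i≡j

  adj-irrefl : ∀ x → ¬ Adj x x
  adj-irrefl (_ , centre) i≢i = i≢i refl

  abstract
    enum : Fin (m ℕ.* 5) ↔ V
    enum = *↔×

  root : V
  root = zero , centre

  H : Graph
  H = graphOn enum root adj? adj-sym adj-irrefl

  presentation : Presentation H
  presentation = graphOn-presentation enum root adj? adj-sym adj-irrefl

  centre-root : ∀ i → Star Adj (i , centre) root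
  centre-root zero    = ε
  centre-root (suc i) = (λ ()) ◅ ε

  to-root : ∀ x → Star Adj x root
  to-root (i , centre) = centre-root i
  to-root (i , suc _)  = _◅_ {j = i , centre} refl (centre-root i)

  connectedOn : ∀ x y → Star Adj x y
  connectedOn x y = to-root x ◅◅ Star.reverse (λ {x} {y} → adj-sym {x} {y}) (to-root y)

  open Bounds presentation connectedOn public using (connected; γ≤-by-retraction)

  -- Sending each vertex to the centre with its index retracts `H` onto the clique.
  γH≤m : ∀ {h} → γwcon H ≐ h → h ≤ m
  γH≤m = γ≤-by-retraction (↔-id (Fin m)) (_, centre) proj₁ (λ _ → refl)
    (λ {x} {y} → nonexpansive x y) dom
    where
    nonexpansive : ∀ x y → Adj x y → proj₁ x ≡ proj₁ y ⊎ proj₁ x ≢ proj₁ y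
    nonexpansive (_ , centre) (_ , centre) i≢j = inj₂ i≢j
    nonexpansive (_ , centre) (_ , suc _)  i≡j = inj₁ i≡j
    nonexpansive (_ , suc _)  (_ , centre) i≡j = inj₁ i≡j

    dom : ∀ x → ∃[ i ] (x ≡ (i , centre) ⊎ Adj x (i , centre))
    dom (i , centre) = i , inj₁ refl
    dom (i , suc _)  = i , inj₂ refl

  -- Lower bound for the prism of the corolla graph

  swapPin : V → V
  swapPin (i , centre) = i , pin
  swapPin (i , pin)    = i , centre
  swapPin (i , leaf t) = i , leaf t

  swapPin-involutive : ∀ x → swapPin (swapPin x) ≡ x
  swapPin-involutive (_ , centre) = refl
  swapPin-involutive (_ , pin)    = refl
  swapPin-involutive (_ , leaf _) = refl

  σ : Permutation′ (Graph.order H)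
  σ = permutationOn enum (mk↔ₛ′ swapPin swapPin swapPin-involutive swapPin-involutive)

  prismPresentation : Presentation (prism H σ)
  prismPresentation = prism-presentation presentation σ
    {f = swapPin} λ u → Inverse.strictlyInverseˡ enum _

  prismConnected : ∀ x y → Star (Presentation.Adj prismPresentation) x y
  prismConnected = prism-connected presentation σ _ connectedOn

  module PrismBounds = Bounds prismPresentation prismConnected
  open PrismBounds using (_∈ᵛ_; _∈ᵛ?_; dominatedOn; convexOn; γ≥-by-labels)

  PrismAdjᵛ : Rel (V ⊎ V) 0ℓ
  PrismAdjᵛ = Presentation.Adj prismPresentation

  -- Chosen such that the leaves (from either copy) attain all three labels, and so
  -- do the two copies of a centre together with a pin.
  label : V ⊎ V → Fin m × Fin 3
  label (inj₁ (i , centre)) = i , zero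
  label (inj₂ (i , centre)) = i , suc zero
  label (inj₁ (i , pin))    = i , suc (suc zero)
  label (inj₂ (i , pin))    = i , suc (suc zero)
  label (inj₁ (i , leaf t)) = i , t
  label (inj₂ (i , leaf t)) = i , t

  Covers : Graph.VertexSet (prism H σ) → Fin m × Fin 3 → Set
  Covers A y = ∃[ x ] x ∈ᵛ A × label x ≡ y

  -- As `σ` fixes leaves, a leaf is adjacent only to its centre and its own copy. Without the
  -- centre, `A` contains one of the two copies of each leaf, and both have the same label.
  centre₁-or-leaves : ∀ {A} → Graph.Dominating (prism H σ) A → ∀ i →
          inj₁ (i , centre) ∈ᵛ A ⊎ (∀ t → Covers A (i , t))
  centre₁-or-leaves {A} dom i with inj₁ (i , centre) ∈ᵛ? A
  ... | yes c∈A = inj₁ c∈A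
  ... | no  c∉A = inj₂ covers
    where
    covers : ∀ t → Covers A (i , t)
    covers t with dominatedOn dom (inj₁ (i , leaf t))
    ... | inj₁ l∈A = inj₁ (i , leaf t) , l∈A , refl
    ... | inj₂ (inj₁ (_ , centre) , c∈A , refl) = contradiction c∈A c∉A
    ... | inj₂ (inj₂ _ , l∈A , refl) = inj₂ (i , leaf t) , l∈A , refl

  centre₂-or-leaves : ∀ {A} → Graph.Dominating (prism H σ) A → ∀ i →
          inj₂ (i , centre) ∈ᵛ A ⊎ (∀ t → Covers A (i , t))
  centre₂-or-leaves {A} dom i with inj₂ (i , centre) ∈ᵛ? A
  ... | yes c∈A = inj₁ c∈A
  ... | no  c∉A = inj₂ covers
    where
    covers : ∀ t → Covers A (i , t)
    covers t with dominatedOn dom (inj₂ (i , leaf t))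
    ... | inj₁ l∈A = inj₂ (i , leaf t) , l∈A , refl
    ... | inj₂ (inj₂ (_ , centre) , c∈A , refl) = contradiction c∈A c∉A
    ... | inj₂ (inj₁ (_ , leaf _) , l∈A , refl) = inj₁ (i , leaf t) , l∈A , refl

  path₂ : ∀ i → WalkIn PrismAdjᵛ U 2 (inj₁ (i , centre)) (inj₂ (i , centre))
  path₂ i = _∷⟨_⟩_ {v = inj₁ (i , pin)} _ refl (_ ∷⟨ refl ⟩ [ _ ])

  -- Each copy of the centre is matched with the pin in the other copy, so the middle vertex of a
  -- walk of length 2 is a pin; both pins have the third label.
  short-walk : ∀ {A k i} → k ≤ 2 →
    WalkIn PrismAdjᵛ (_∈ᵛ A) k (inj₁ (i , centre)) (inj₂ (i , centre)) →
    Covers A (i , suc (suc zero))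
  short-walk {i = i} _ (_∷⟨_⟩_ {v = inj₁ (_ , pin)} _ refl (pin∈A ∷⟨ _ ⟩ [ _ ])) =
    inj₁ (i , pin) , pin∈A , refl
  short-walk {i = i} _ (_∷⟨_⟩_ {v = inj₂ _} _ refl (pin∈A ∷⟨ _ ⟩ [ _ ])) =
    inj₂ (i , pin) , pin∈A , refl
  short-walk (s≤s (s≤s ())) (_ ∷⟨ _ ⟩ _ ∷⟨ _ ⟩ _ ∷⟨ _ ⟩ _)

  -- The centres themselves supply two labels; as they have a walk of length 2 between them,
  -- convexity supplies a pin for the third.
  centres-cover : ∀ {A i} → Graph.WeaklyConvex (prism H σ) A →
    inj₁ (i , centre) ∈ᵛ A → inj₂ (i , centre) ∈ᵛ A → ∀ t → Covers A (i , t)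
  centres-cover {i = i} wc c₁∈A c₂∈A zero       = inj₁ (i , centre) , c₁∈A , refl
  centres-cover {i = i} wc c₁∈A c₂∈A (suc zero) = inj₂ (i , centre) , c₂∈A , refl
  centres-cover {i = i} wc c₁∈A c₂∈A (suc (suc zero)) =
    let _ , k≤2 , w = convexOn wc c₁∈A c₂∈A (path₂ i) in short-walk k≤2 w

  γσH≥3m : ∀ {h} → γwcon prism H σ ≐ h → m ℕ.* 3 ≤ h
  γσH≥3m = γ≥-by-labels *↔× label hit
    where
    hit : ∀ A → Graph.WeaklyConvexDominating (prism H σ) A → ∀ it → Covers A it
    hit A (wc , dom) (i , t) with centre₁-or-leaves dom i | centre₂-or-leaves dom i
    ... | inj₂ covers | _           = covers t
    ... | inj₁ _      | inj₂ covers = covers t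
    ... | inj₁ c₁∈A   | inj₁ c₂∈A   = centres-cover wc c₁∈A c₂∈A t

-- Arithmetic of the two gaps

k+b≤a⇒a-b≥k : ∀ {a b k} → k + b ≤ a → + a - + b ≥ + k
k+b≤a⇒a-b≥k {a} {b} {k} k+b≤a = subst (ℤ._≤_ (+ k))
  (sym (trans (ℤ.m-n≡m⊖n a b) (ℤ.⊖-≥ (ℕ.≤-trans (ℕ.m≤n+m b k) k+b≤a))))
  (ℤ.+≤+ (ℕ.m+n≤o⇒m≤o∸n k k+b≤a))

-- For `m = 8 + k` the product `m * m` splits as `k * m` plus `8 * m`, and `k * m` is at least `k`.
grid-gap : ∀ k {g πg} → let m = 8 + k in
  m ℕ.* m ≤ g → πg ≤ 2 ℕ.* (2 ℕ.* m) + 2 ℕ.* (2 ℕ.* m) → k + πg ≤ g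
grid-gap k {g} {πg} m²≤g πg≤8m = begin
  k + πg                                              ≤⟨ ℕ.+-mono-≤ (ℕ.m≤m*n k m) πg≤8m ⟩
  k ℕ.* m + (2 ℕ.* (2 ℕ.* m) + 2 ℕ.* (2 ℕ.* m)) ≡⟨ regroup k m ⟩
  m ℕ.* m                                             ≤⟨ m²≤g ⟩
  g                                                   ∎
  where
  open ℕ.≤-Reasoning
  m = 8 + k
  regroup : ∀ k m → k ℕ.* m + (2 ℕ.* (2 ℕ.* m) + 2 ℕ.* (2 ℕ.* m)) ≡ (8 + k) ℕ.* m
  regroup = solve-∀

-- With `suc k` centres the gap is at least `3 * suc k` minus `2 * suc k`, which exceeds `k`.
corolla-gap : ∀ k {h σh} → suc k ℕ.* 3 ≤ σh → h ≤ suc k → k + 2 ℕ.* h ≤ σh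
corolla-gap k {h} {σh} 3m≤σh h≤m = begin
  k + 2 ℕ.* h         ≤⟨ ℕ.+-mono-≤ (ℕ.n≤1+n k) (ℕ.*-monoʳ-≤ 2 h≤m) ⟩
  suc k + 2 ℕ.* suc k ≡⟨ ℕ.*-comm 3 (suc k) ⟩
  suc k ℕ.* 3         ≤⟨ 3m≤σh ⟩
  σh                  ∎
  where open ℕ.≤-Reasoning

mainTheorem2 : ∀ (k : ℕ) →
    Σ[ G ∈ Graph ] Σ[ H ∈ Graph ]
    Graph.Connected G × Graph.Connected H ×
    (Σ[ π ∈ Permutation′ (Graph.order G) ] Σ[ σ ∈ Permutation′ (Graph.order H) ]
    ∃[ g ] ∃[ πg ] ∃[ h ] ∃[ σh ]
    (γwcon G ≐ g) × (γwcon prism G π ≐ πg) ×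
    (γwcon H ≐ h) × (γwcon prism H σ ≐ σh) ×
    (+ g - + πg ≥ + k) × (+ σh - + 2 * + h ≥ + k))
mainTheorem2 k =
  -- The modules take the predecessor of `m`: `7 + k` gives `8 + k` hubs on each side of a layer,
  -- and `k` gives `suc k` centres.
  let module G = GridGraph (7 + k)
      module H = CorollaGraph k
      g  , γG  = Geodesics.γwcon-exists G.G G.connected
      πg , γπG = Geodesics.γwcon-exists (prism G.G G.π) G.PrismBounds.connected
      h  , γH  = Geodesics.γwcon-exists H.H H.connected
      σh , γσH = Geodesics.γwcon-exists (prism H.H H.σ) H.PrismBounds.connected
  in G.G , H.H , G.connected , H.connected , G.π , H.σ ,
     g , πg , h , σh , γG , γπG , γH , γσH ,
     k+b≤a⇒a-b≥k (grid-gap k (G.γG≥m² γG) (G.γπG≤8m γπG)) ,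
     subst (λ z → + σh - z ≥ + k) (ℤ.pos-* 2 h)
       (k+b≤a⇒a-b≥k (corolla-gap k (H.γσH≥3m γσH) (H.γH≤m γH)))
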